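{- Let $(\mathcal{S},\Sigma,ar,coar)$ be a closed monoidal signature and let $\mathscr{C}_\Sigma$ be the category of string diagrams with brackets over it (defined in the context). Then $\mathscr{C}_\Sigma$, with monoidal product given by concatenation of words on objects and by $\otimes$ on terms, monoidal unit the empty word $I$, and symmetry given by the terms $\sigma_{X,Y}$, is a closed symmetric monoidal category.
   Context: Words. Given a set $\mathcal{S}$ of sorts, define covariant words $X$, contravariant words $X^\ast$ and mixed words $\mathbf{X}$ by the mutually recursive grammar $X ::= I \mid AX \mid [\mathbf{X}]X$, $X^\ast ::= I \mid A^\ast X^\ast \mid [\mathbf{X}]^\ast X^\ast$, $\mathbf{X} ::= I \mid X^\ast\mathbf{X} \mid X\mathbf{X}$, where $A\in\mathcal{S}$, $I$ is the empty word, juxtaposition is concatenation, $[\,]$ are formal brackets and $(-)^\ast$ marks formal duals. $\mathcal{S}^\sharp$ is the set of covariant words. Duality on words: $(A)^\ast=A^\ast$, $(A^\ast)^\ast=A$, $I^\ast=I$, $(X\mathbf{Y})^\ast=\mathbf{Y}^\ast X^\ast$, $(\mathbf{Y}X)^\ast=X^\ast\mathbf{Y}^\ast$, $([\mathbf{X}])^\ast=[\mathbf{X}^\ast]^\ast$, $([\mathbf{X}]^\ast)^\ast=[\mathbf{X}^\ast]$. A closed monoidal signature $(\mathcal{S},\Sigma,ar,coar)$ consists of a set $\mathcal{S}$ of sorts, a set $\Sigma$ of generators and functions $ar,coar:\Sigma\to\mathcal{S}^\sharp$ (domain and codomain). Terms. Covariant terms are built from: the bracket generators (typed as indicated, for all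 words of the appropriate kinds) $\mathrm{bcup}:[I]\to I$; $\mathrm{bcap}:I\to[I]$; $\mathrm{din}_{X,\mathbf{Y}}:X[\mathbf{Y}]\to[X\mathbf{Y}]$; $\mathrm{dout}_{X,Y}:[XY]\to X[Y]$; $\mathrm{uin}_{X^\ast,Y^\ast,\mathbf{Z},W^\ast}:[X^\ast Y^\ast[\mathbf{Z}]W^\ast]\to[X^\ast[Y^\ast\mathbf{Z}]W^\ast]$; $\mathrm{uout}_{\mathbf{X},Y^\ast,\mathbf{Z},\mathbf{W}}:[\mathbf{X}[Y^\ast\mathbf{Z}]\mathbf{W}]\to[\mathbf{X}Y^\ast[\mathbf{Z}]\mathbf{W}]$; $\mathrm{xcup}_{X,\mathbf{Y}}:X[X^\ast\mathbf{Y}]\to[\mathbf{Y}]$; $\mathrm{rcap}_{\mathbf{X},Y,\mathbf{Z}}:[\mathbf{X}\mathbf{Z}]\to[\mathbf{X}Y^\ast Y\mathbf{Z}]$; $\mathrm{rcup}_{\mathbf{X},Y,\mathbf{Z}}:[\mathbf{X}Y][Y^\ast\mathbf{Z}]\to[\mathbf{X}\mathbf{Z}]$; and their mirror images $\mathrm{din}'_{\mathbf{Y},X}:[\mathbf{Y}]X\to[\mathbf{Y}X]$; $\mathrm{dout}'_{Y,X}:[YX]\to[Y]X$; $\mathrm{uin}'_{W^\ast,\mathbf{Z},Y^\ast,X^\ast}:[W^\ast[\mathbf{Z}]Y^\ast X^\ast]\to[W^\ast[\mathbf{Z}Y^\ast]X^\ast]$; $\mathrm{uout}'_{\mathbf{W},\mathbf{Z},Y^\ast,\mathbf{X}}:[\mathbf{W}[\mathbf{Z}Y^\ast]\mathbf{X}]\to[\mathbf{W}[\mathbf{Z}]Y^\ast\mathbf{X}]$;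 $\mathrm{xcup}'_{\mathbf{Y},X}:[\mathbf{Y}X^\ast]X\to[\mathbf{Y}]$; $\mathrm{rcap}'_{\mathbf{Z},Y,\mathbf{X}}:[\mathbf{Z}\mathbf{X}]\to[\mathbf{Z}YY^\ast\mathbf{X}]$; $\mathrm{rcup}'_{\mathbf{Z},Y,\mathbf{X}}:[\mathbf{Z}Y^\ast][Y\mathbf{X}]\to[\mathbf{Z}\mathbf{X}]$; together with identities $\mathrm{id}_X$, generators $f:ar(f)\to coar(f)$ for $f\in\Sigma$, composition $t_1;t_2:X\to Z$ for $t_1:X\to Y,t_2:Y\to Z$, tensor $t_1\otimes t_2:XZ\to YW$ for $t_1:X\to Y,t_2:Z\to W$, symmetries $\sigma_{X,Y}:XY\to YX$, and bracketing $[\mathbf{t}]:[\mathbf{X}]\to[\mathbf{Y}]$ for a mixed term $\mathbf{t}:\mathbf{X}\to\mathbf{Y}$. Contravariant terms are the formal duals: each term $t:X\to Y$ has a dual $t^\ast:Y^\ast\to X^\ast$, with $(t^\ast)^\ast=t$, $(\mathrm{id}_X)^\ast=\mathrm{id}_{X^\ast}$, $(t_1;t_2)^\ast=t_2^\ast;t_1^\ast$, $(t_1\otimes t_2)^\ast=t_2^\ast\otimes t_1^\ast$, $(\sigma_{X,Y})^\ast=\sigma_{Y^\ast,X^\ast}$, $([\mathbf{t}])^\ast=[\mathbf{t}^\ast]^\ast$. Mixed terms are covariant terms, contravariant terms, composites and tensors of mixed terms, and the symmetries $\sigma_{X,Y^\ast}:XY^\ast\to Y^\ast X$, $\sigma_{X^\ast,Y}:X^\ast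 Y\to YX^\ast$ (with $(\sigma_{X,Y^\ast})^\ast=\sigma_{Y,X^\ast}$, $(\sigma_{X^\ast,Y})^\ast=\sigma_{Y^\ast,X}$). Only well-typed terms are considered. Equations. Let $\cong$ be the smallest congruence on terms (closed under $;$, $\otimes$, $(-)^\ast$, $[-]$) containing: the axioms of symmetric monoidal categories (unit and associativity laws for $;$ and $\otimes$, interchange $(t_1\otimes t_2);(t_3\otimes t_4)=(t_1;t_3)\otimes(t_2;t_4)$, symmetries involutive and natural), for covariant, contravariant and mixed terms including the mixed symmetries ($\sigma_{X,Y^\ast};\sigma_{Y^\ast,X}=\mathrm{id}$, $\sigma_{X^\ast,Y};\sigma_{Y,X^\ast}=\mathrm{id}$, and naturality); crossing: $(\mathrm{id}_X\otimes[\sigma_{\mathbf{Y},X^\ast}]);\mathrm{xcup}_{X,\mathbf{Y}}=\sigma_{X,[\mathbf{Y}X^\ast]};\mathrm{xcup}'_{\mathbf{Y},X}$; $\mathrm{rcap}_{\mathbf{X},Y,\mathbf{Z}};[\mathrm{id}_{\mathbf{X}}\otimes\sigma_{Y^\ast,Y}\otimes\mathrm{id}_{\mathbf{Z}}]=\mathrm{rcap}'_{\mathbf{X},Y,\mathbf{Z}}$; $\mathrm{din}_{X,Y};\mathrm{dout}_{X,Y}=\mathrm{id}$, $\mathrm{dout}_{X,Y};\mathrm{din}_{X,Y}=\mathrm{id}$; $\mathrm{uin}_{X^\ast,Y^\ast,\mathbf{Z},W^\ast};\mathrm{uout}_{X^\ast,Y^\ast,\mathbf{Z},W^\ast}=\mathrm{id}$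 and $\mathrm{uout};\mathrm{uin}=\mathrm{id}$ (same indices); naturality: for $t_0:X\to Y$ and $\mathbf{t}_1:\mathbf{Z}\to\mathbf{W}$, $(t_0\otimes[\mathrm{id}_{Y^\ast}\otimes\mathbf{t}_1]);\mathrm{xcup}_{Y,\mathbf{W}}=(\mathrm{id}_X\otimes[t_0^\ast\otimes\mathrm{id}_{\mathbf{Z}}]);\mathrm{xcup}_{X,\mathbf{Z}};[\mathbf{t}_1]$ and $[\mathrm{id}_{\mathbf{U}}\otimes\mathbf{t}_1];\mathrm{rcap}_{\mathbf{U},Y,\mathbf{W}};[\mathrm{id}_{\mathbf{U}}\otimes t_0^\ast\otimes\mathrm{id}_{Y\mathbf{W}}]=\mathrm{rcap}_{\mathbf{U},X,\mathbf{Z}};[\mathrm{id}_{\mathbf{U}X^\ast}\otimes t_0\otimes\mathbf{t}_1]$; for $\mathbf{t}_0:\mathbf{Y}\to\mathbf{Z}$, $\mathbf{t}_1:\mathbf{U}\to\mathbf{V}$, $(\mathrm{xcup}_{X,\mathbf{Y}W}\otimes\mathrm{id}_{[W^\ast\mathbf{U}]});([\mathbf{t}_0\otimes\mathrm{id}_W]\otimes[\mathrm{id}_{W^\ast}\otimes\mathbf{t}_1]);\mathrm{rcup}_{\mathbf{Z},W,\mathbf{V}}=(\mathrm{id}_X\otimes\mathrm{rcup}_{X^\ast\mathbf{Y},W,\mathbf{U}});\mathrm{xcup}_{X,\mathbf{Y}\mathbf{U}};[\mathbf{t}_0\otimes\mathbf{t}_1]$; yanking: $(\mathrm{id}_X\otimes\mathrm{rcap}_{I,X,\mathbf{Y}});\mathrm{xcup}_{X,X\mathbf{Y}}=\mathrm{din}_{X,\mathbf{Y}}$;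 $\mathrm{rcap}_{\mathbf{X},Y,[Y^\ast\mathbf{Z}]\mathbf{W}};[\mathrm{id}_{\mathbf{X}Y^\ast}\otimes\mathrm{xcup}_{Y,\mathbf{Z}}\otimes\mathrm{id}_{\mathbf{W}}]=\mathrm{uout}_{\mathbf{X},Y^\ast,\mathbf{Z},\mathbf{W}}$; $(\mathrm{id}_{[X]}\otimes\mathrm{rcap}_{I,X,\mathbf{Z}});\mathrm{rcup}_{I,X,X\mathbf{Z}}=(\mathrm{dout}'_{I,X}\otimes\mathrm{id}_{[\mathbf{Z}]});(\mathrm{id}_{[I]}\otimes\mathrm{din}_{X,\mathbf{Z}});(\mathrm{bcup}\otimes\mathrm{id}_{[X\mathbf{Z}]})$; bubbles: $\mathrm{bcap};\mathrm{bcup}=\mathrm{id}_I$, $\mathrm{bcup};\mathrm{bcap}=\mathrm{id}_{[I]}$, $(\mathrm{bcap}\otimes\mathrm{id}_{[\mathbf{X}]});\mathrm{rcup}_{I,I,\mathbf{X}}=\mathrm{id}_{[\mathbf{X}]}$, $[\mathbf{t}_0];[\mathbf{t}_1]=[\mathbf{t}_0;\mathbf{t}_1]$, $[\mathrm{id}_{\mathbf{X}}]=\mathrm{id}_{[\mathbf{X}]}$. $\mathscr{C}_\Sigma$ is the category whose objects are the elements of $\mathcal{S}^\sharp$ and whose morphisms $X\to Y$ are well-typed covariant terms $X\to Y$ modulo $\cong$.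
   Formalization: The duality equations for symmetries are ill-typed as written and are corrected to (σ_{X,Y})* = σ_{X*,Y*}, and likewise for mixed symmetries; the hexagon laws and id⊗id = id are counted among the axioms of symmetric monoidal categories. -}

module Defs where

open import Data.Unit using (⊤; tt)
open import Data.Empty using (⊥)
open import Data.Product using (Σ; _×_; _,_; proj₁; proj₂)
open import Data.List using (List; []; _∷_; _++_)
open import Data.List.Properties using (++-assoc)
open import Relation.Binary.PropositionalEquality using (_≡_; refl; cong; sym)
open import Relation.Binary.Structures using (IsEquivalence)

data Pol : Set where
  pos neg : Pol

-- Letters: a sort A, a dual sort A*, a bracket [W] and a dual bracket [W]*
-- (W a mixed word).  A mixed word is any list of letters; covariant
-- (resp. contravariant) words are the lists all of whose letters are
-- covariant (resp. contravariant) -- this is exactly the grammar of the paper.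
data Letter (S : Set) : Set where
  sort  : S → Letter S
  dsort : S → Letter S
  br    : List (Letter S) → Letter S
  dbr   : List (Letter S) → Letter S

Word : Set → Set
Word S = List (Letter S)

⟪_⟫ : ∀ {S} → Word S → Word S
⟪ w ⟫ = br w ∷ []

mutual
  dualL : ∀ {S} → Letter S → Letter S
  dualL (sort A)  = dsort A
  dualL (dsort A) = sort A
  dualL (br w)    = dbr (dualW w)
  dualL (dbr w)   = br (dualW w)

  dualW : ∀ {S} → Word S → Word S
  dualW []      = []
  dualW (l ∷ w) = dualW w ++ (dualL l ∷ [])

infix 30 _ᵈ
_ᵈ : ∀ {S} → Word S → Word S
w ᵈ = dualW w

pol : ∀ {S} → Letter S → Pol
pol (sort _)  = pos
pol (dsort _) = neg
pol (br _)    = pos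
pol (dbr _)   = neg

SameP : Pol → Pol → Set
SameP pos pos = ⊤
SameP neg neg = ⊤
SameP pos neg = ⊥
SameP neg pos = ⊥

Pure : ∀ {S} → Pol → Word S → Set
Pure p []      = ⊤
Pure p (l ∷ w) = SameP (pol l) p × Pure p w

pure-++ : ∀ {S} p (X Y : Word S) → Pure p X → Pure p Y → Pure p (X ++ Y)
pure-++ p []      Y _        pY = pY
pure-++ p (l ∷ X) Y (e , pX) pY = e , pure-++ p X Y pX pY

flipP : Pol → Pol
flipP pos = neg
flipP neg = pos

private
  sameP-dual : ∀ {S} p (l : Letter S) → SameP (pol l) p → SameP (pol (dualL l)) (flipP p)
  sameP-dual pos (sort _)  e = tt
  sameP-dual pos (br _)    e = tt
  sameP-dual neg (dsort _) e = tt
  sameP-dual neg (dbr _)   e = tt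

pure-dual : ∀ {S} p (X : Word S) → Pure p X → Pure (flipP p) (X ᵈ)
pure-dual p []      _        = tt
pure-dual p (l ∷ X) (e , pX) =
  pure-++ (flipP p) (X ᵈ) (dualL l ∷ []) (pure-dual p X pX) (sameP-dual p l e , tt)

record CWord (S : Set) : Set where
  constructor cw
  field
    word : Word S
    pure : Pure pos word
open CWord public

record Signature : Set₁ where
  field
    Sort : Set
    Gen  : Set
    ar   : Gen → CWord Sort
    coar : Gen → CWord Sort

-- The data fixed by the theorem: category data, tensor on objects and
-- morphisms, unit object and symmetry.  (Composition is diagrammatic: f ⨾ g.)
record SMCData : Set₁ where
  infixr 9 _⨾_
  infixr 10 _⊗₁_
  infixr 10 _⊗₀_
  infix 4 _≈_
  field
    Obj  : Set
    Hom  : Obj → Obj → Set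
    _≈_  : ∀ {A B} → Hom A B → Hom A B → Set
    idC  : ∀ {A} → Hom A A
    _⨾_  : ∀ {A B C} → Hom A B → Hom B C → Hom A C
    _⊗₀_ : Obj → Obj → Obj
    _⊗₁_ : ∀ {A B C D} → Hom A B → Hom C D → Hom (A ⊗₀ C) (B ⊗₀ D)
    𝟙    : Obj
    sym⇒ : ∀ {A B} → Hom (A ⊗₀ B) (B ⊗₀ A)

record IsClosedSymmetricMonoidal (D : SMCData) : Set where
  open SMCData D
  field
    ≈-equiv : ∀ {A B} → IsEquivalence (_≈_ {A} {B})
    ⨾-cong  : ∀ {A B C} {f f' : Hom A B} {g g' : Hom B C} →
              f ≈ f' → g ≈ g' → f ⨾ g ≈ f' ⨾ g'
    idˡ     : ∀ {A B} (f : Hom A B) → idC ⨾ f ≈ f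
    idʳ     : ∀ {A B} (f : Hom A B) → f ⨾ idC ≈ f
    assoc   : ∀ {A B C E} (f : Hom A B) (g : Hom B C) (h : Hom C E) →
              (f ⨾ g) ⨾ h ≈ f ⨾ (g ⨾ h)
    ⊗-cong  : ∀ {A B C E} {f f' : Hom A B} {g g' : Hom C E} →
              f ≈ f' → g ≈ g' → f ⊗₁ g ≈ f' ⊗₁ g'
    ⊗-id    : ∀ {A B} → idC {A} ⊗₁ idC {B} ≈ idC
    ⊗-⨾     : ∀ {A B C A' B' C'} (f : Hom A B) (g : Hom B C)
                (f' : Hom A' B') (g' : Hom B' C') →
              (f ⨾ g) ⊗₁ (f' ⨾ g') ≈ (f ⊗₁ f') ⨾ (g ⊗₁ g')
    α⇒      : ∀ {A B C} → Hom ((A ⊗₀ B) ⊗₀ C) (A ⊗₀ (B ⊗₀ C))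
    α⇐      : ∀ {A B C} → Hom (A ⊗₀ (B ⊗₀ C)) ((A ⊗₀ B) ⊗₀ C)
    α-iso₁  : ∀ {A B C} → α⇒ {A} {B} {C} ⨾ α⇐ ≈ idC
    α-iso₂  : ∀ {A B C} → α⇐ {A} {B} {C} ⨾ α⇒ ≈ idC
    α-nat   : ∀ {A B C A' B' C'} (f : Hom A A') (g : Hom B B') (h : Hom C C') →
              ((f ⊗₁ g) ⊗₁ h) ⨾ α⇒ ≈ α⇒ ⨾ (f ⊗₁ (g ⊗₁ h))
    λ⇒      : ∀ {A} → Hom (𝟙 ⊗₀ A) A
    λ⇐      : ∀ {A} → Hom A (𝟙 ⊗₀ A)
    λ-iso₁  : ∀ {A} → λ⇒ {A} ⨾ λ⇐ ≈ idC
    λ-iso₂  : ∀ {A} → λ⇐ {A} ⨾ λ⇒ ≈ idC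
    λ-nat   : ∀ {A B} (f : Hom A B) → (idC {𝟙} ⊗₁ f) ⨾ λ⇒ ≈ λ⇒ ⨾ f
    ρ⇒      : ∀ {A} → Hom (A ⊗₀ 𝟙) A
    ρ⇐      : ∀ {A} → Hom A (A ⊗₀ 𝟙)
    ρ-iso₁  : ∀ {A} → ρ⇒ {A} ⨾ ρ⇐ ≈ idC
    ρ-iso₂  : ∀ {A} → ρ⇐ {A} ⨾ ρ⇒ ≈ idC
    ρ-nat   : ∀ {A B} (f : Hom A B) → (f ⊗₁ idC {𝟙}) ⨾ ρ⇒ ≈ ρ⇒ ⨾ f
    pentagon : ∀ {A B C E} →
               α⇒ {A ⊗₀ B} {C} {E} ⨾ α⇒ {A} {B} {C ⊗₀ E}
               ≈ (α⇒ {A} {B} {C} ⊗₁ idC {E}) ⨾ α⇒ {A} {B ⊗₀ C} {E} ⨾ (idC {A} ⊗₁ α⇒ {B} {C} {E})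
    triangle : ∀ {A B} →
               α⇒ {A} {𝟙} {B} ⨾ (idC {A} ⊗₁ λ⇒ {B}) ≈ ρ⇒ {A} ⊗₁ idC {B}
    sym-nat  : ∀ {A B A' B'} (f : Hom A A') (g : Hom B B') →
               (f ⊗₁ g) ⨾ sym⇒ ≈ sym⇒ ⨾ (g ⊗₁ f)
    sym-inv  : ∀ {A B} → sym⇒ {A} {B} ⨾ sym⇒ {B} {A} ≈ idC
    hexagon  : ∀ {A B C} →
               α⇒ {A} {B} {C} ⨾ sym⇒ {A} {B ⊗₀ C} ⨾ α⇒ {B} {C} {A}
               ≈ (sym⇒ {A} {B} ⊗₁ idC {C}) ⨾ α⇒ {B} {A} {C} ⨾ (idC {B} ⊗₁ sym⇒ {A} {C})
    _⊸_      : Obj → Obj → Obj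
    ev       : ∀ {B C} → Hom ((B ⊸ C) ⊗₀ B) C
    curry    : ∀ {A B C} → Hom (A ⊗₀ B) C → Hom A (B ⊸ C)
    curry-β  : ∀ {A B C} (f : Hom (A ⊗₀ B) C) → (curry f ⊗₁ idC {B}) ⨾ ev ≈ f
    curry-η  : ∀ {A B C} (f : Hom (A ⊗₀ B) C) (g : Hom A (B ⊸ C)) →
               (g ⊗₁ idC {B}) ⨾ ev ≈ f → g ≈ curry f

module Syntax (Sig : Signature) where
  open Signature Sig

  W : Set
  W = Word Sort

  infixr 9 _⨾_
  infixr 10 _⊗_
  infix 40 _†

  -- Mixed terms (covariant, contravariant and mixed terms all live here;
  -- covariant terms are singled out by the predicate Cov below).
  -- Purity arguments record the kind (covariant / contravariant) of indices.
  data Tm : W → W → Set where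
    gen   : (f : Gen) → Tm (word (ar f)) (word (coar f))
    bcup  : Tm ⟪ [] ⟫ []
    bcap  : Tm [] ⟪ [] ⟫
    din   : (X Y : W) → Pure pos X → Tm (X ++ ⟪ Y ⟫) ⟪ X ++ Y ⟫
    dout  : (X Y : W) → Pure pos X → Pure pos Y → Tm ⟪ X ++ Y ⟫ (X ++ ⟪ Y ⟫)
    uin   : (X Y Z V : W) → Pure neg X → Pure neg Y → Pure neg V →
            Tm ⟪ X ++ Y ++ ⟪ Z ⟫ ++ V ⟫ ⟪ X ++ ⟪ Y ++ Z ⟫ ++ V ⟫
    uout  : (X Y Z V : W) → Pure neg Y →
            Tm ⟪ X ++ ⟪ Y ++ Z ⟫ ++ V ⟫ ⟪ X ++ Y ++ ⟪ Z ⟫ ++ V ⟫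
    xcup  : (X Y : W) → Pure pos X → Tm (X ++ ⟪ X ᵈ ++ Y ⟫) ⟪ Y ⟫
    rcap  : (X Y Z : W) → Pure pos Y → Tm ⟪ X ++ Z ⟫ ⟪ X ++ Y ᵈ ++ Y ++ Z ⟫
    rcup  : (X Y Z : W) → Pure pos Y → Tm (⟪ X ++ Y ⟫ ++ ⟪ Y ᵈ ++ Z ⟫) ⟪ X ++ Z ⟫
    din'  : (Y X : W) → Pure pos X → Tm (⟪ Y ⟫ ++ X) ⟪ Y ++ X ⟫
    dout' : (Y X : W) → Pure pos Y → Pure pos X → Tm ⟪ Y ++ X ⟫ (⟪ Y ⟫ ++ X)
    uin'  : (V Z Y X : W) → Pure neg V → Pure neg Y → Pure neg X →
            Tm ⟪ V ++ ⟪ Z ⟫ ++ Y ++ X ⟫ ⟪ V ++ ⟪ Z ++ Y ⟫ ++ X ⟫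
    uout' : (V Z Y X : W) → Pure neg Y →
            Tm ⟪ V ++ ⟪ Z ++ Y ⟫ ++ X ⟫ ⟪ V ++ ⟪ Z ⟫ ++ Y ++ X ⟫
    xcup' : (Y X : W) → Pure pos X → Tm (⟪ Y ++ X ᵈ ⟫ ++ X) ⟪ Y ⟫
    rcap' : (Z Y X : W) → Pure pos Y → Tm ⟪ Z ++ X ⟫ ⟪ Z ++ Y ++ Y ᵈ ++ X ⟫
    rcup' : (Z Y X : W) → Pure pos Y → Tm (⟪ Z ++ Y ᵈ ⟫ ++ ⟪ Y ++ X ⟫) ⟪ Z ++ X ⟫
    id    : (X : W) → Tm X X
    _⨾_   : ∀ {A B C} → Tm A B → Tm B C → Tm A C
    _⊗_   : ∀ {A B C D} → Tm A B → Tm C D → Tm (A ++ C) (B ++ D)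
    σ     : (X Y : W) → Tm (X ++ Y) (Y ++ X)
    [_]   : ∀ {A B} → Tm A B → Tm ⟪ A ⟫ ⟪ B ⟫
    _†    : ∀ {A B} → Tm A B → Tm (B ᵈ) (A ᵈ)

  Cov : ∀ {A B} → Tm A B → Set
  Cov (gen f)           = ⊤
  Cov bcup              = ⊤
  Cov bcap              = ⊤
  Cov (din _ _ _)       = ⊤
  Cov (dout _ _ _ _)    = ⊤
  Cov (uin _ _ _ _ _ _ _) = ⊤
  Cov (uout _ _ _ _ _)  = ⊤
  Cov (xcup _ _ _)      = ⊤
  Cov (rcap _ _ _ _)    = ⊤
  Cov (rcup _ _ _ _)    = ⊤
  Cov (din' _ _ _)      = ⊤
  Cov (dout' _ _ _ _)   = ⊤
  Cov (uin' _ _ _ _ _ _ _) = ⊤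
  Cov (uout' _ _ _ _ _) = ⊤
  Cov (xcup' _ _ _)     = ⊤
  Cov (rcap' _ _ _ _)   = ⊤
  Cov (rcup' _ _ _ _)   = ⊤
  Cov (id X)            = Pure pos X
  Cov (t ⨾ u)           = Cov t × Cov u
  Cov (t ⊗ u)           = Cov t × Cov u
  Cov (σ X Y)           = Pure pos X × Pure pos Y
  Cov [ t ]             = ⊤
  Cov (t †)             = ⊥

  -- composition along a propositional equality of words (used only to
  -- re-associate concatenations, which is not definitional in Agda)
  cast : ∀ {A A' B B'} → A ≡ A' → B ≡ B' → Tm A B → Tm A' B'
  cast refl refl t = t

  infixr 9 _⨾⟨_⟩_
  _⨾⟨_⟩_ : ∀ {A B B' C} → Tm A B → B ≡ B' → Tm B' C → Tm A C
  t ⨾⟨ e ⟩ u = cast refl e t ⨾ u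

  -- The congruence ≅.  It is stated heterogeneously (the two sides may have
  -- types that are only propositionally equal, e.g. (A ++ B) ++ C vs
  -- A ++ (B ++ C)); every axiom relates terms of (propositionally) equal type.
  infix 4 _≅_
  data _≅_ : ∀ {A B C D} → Tm A B → Tm C D → Set where
    ≅-refl  : ∀ {A B} {t : Tm A B} → t ≅ t
    ≅-sym   : ∀ {A B C D} {t : Tm A B} {u : Tm C D} → t ≅ u → u ≅ t
    ≅-trans : ∀ {A B C D E F} {t : Tm A B} {u : Tm C D} {v : Tm E F} →
              t ≅ u → u ≅ v → t ≅ v
    ⨾-cong  : ∀ {A B C A' B' C'} {t : Tm A B} {t' : Tm A' B'} {u : Tm B C} {u' : Tm B' C'} →
              t ≅ t' → u ≅ u' → t ⨾ u ≅ t' ⨾ u'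
    ⊗-cong  : ∀ {A B C D A' B' C' D'} {t : Tm A B} {t' : Tm A' B'} {u : Tm C D} {u' : Tm C' D'} →
              t ≅ t' → u ≅ u' → t ⊗ u ≅ t' ⊗ u'
    †-cong  : ∀ {A B A' B'} {t : Tm A B} {t' : Tm A' B'} → t ≅ t' → t † ≅ t' †
    []-cong : ∀ {A B A' B'} {t : Tm A B} {t' : Tm A' B'} → t ≅ t' → [ t ] ≅ [ t' ]
    idˡ      : ∀ {A B} (t : Tm A B) → id A ⨾ t ≅ t
    idʳ      : ∀ {A B} (t : Tm A B) → t ⨾ id B ≅ t
    ⨾-assoc  : ∀ {A B C D} (t : Tm A B) (u : Tm B C) (v : Tm C D) → (t ⨾ u) ⨾ v ≅ t ⨾ (u ⨾ v)
    ⊗-unitˡ  : ∀ {A B} (t : Tm A B) → id [] ⊗ t ≅ t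
    ⊗-unitʳ  : ∀ {A B} (t : Tm A B) → t ⊗ id [] ≅ t
    ⊗-assoc  : ∀ {A B C D E F} (t : Tm A B) (u : Tm C D) (v : Tm E F) →
               (t ⊗ u) ⊗ v ≅ t ⊗ (u ⊗ v)
    ⊗-id     : (X Y : W) → id X ⊗ id Y ≅ id (X ++ Y)
    interchange : ∀ {A B C D E F} (t₁ : Tm A B) (t₂ : Tm D E) (t₃ : Tm B C) (t₄ : Tm E F) →
               (t₁ ⊗ t₂) ⨾ (t₃ ⊗ t₄) ≅ (t₁ ⨾ t₃) ⊗ (t₂ ⨾ t₄)
    σ-inv    : (X Y : W) → σ X Y ⨾ σ Y X ≅ id (X ++ Y)
    σ-nat    : ∀ {X X' Y Y'} (t : Tm X X') (u : Tm Y Y') → (t ⊗ u) ⨾ σ X' Y' ≅ σ X Y ⨾ (u ⊗ t)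
    hexagon₁ : (X Y Z : W) →
               σ X (Y ++ Z) ≅ (σ X Y ⊗ id Z) ⨾⟨ ++-assoc Y X Z ⟩ (id Y ⊗ σ X Z)
    hexagon₂ : (X Y Z : W) →
               σ (X ++ Y) Z ≅ (id X ⊗ σ Y Z) ⨾⟨ sym (++-assoc X Z Y) ⟩ (σ X Z ⊗ id Y)
    †-invol  : ∀ {A B} (t : Tm A B) → (t †) † ≅ t
    †-id     : (X : W) → id X † ≅ id (X ᵈ)
    †-⨾      : ∀ {A B C} (t : Tm A B) (u : Tm B C) → (t ⨾ u) † ≅ u † ⨾ t †
    †-⊗      : ∀ {A B C D} (t : Tm A B) (u : Tm C D) → (t ⊗ u) † ≅ u † ⊗ t †
    †-σ      : (X Y : W) → σ X Y † ≅ σ (X ᵈ) (Y ᵈ)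
    x-cross  : (X Y : W) (pX : Pure pos X) →
               (id X ⊗ [ σ Y (X ᵈ) ]) ⨾ xcup X Y pX ≅ σ X ⟪ Y ++ X ᵈ ⟫ ⨾ xcup' Y X pX
    r-cross  : (X Y Z : W) (pY : Pure pos Y) →
               rcap X Y Z pY ⨾⟨ cong (λ w → ⟪ X ++ w ⟫) (sym (++-assoc (Y ᵈ) Y Z)) ⟩
                 [ id X ⊗ (σ (Y ᵈ) Y ⊗ id Z) ]
               ≅ rcap' X Y Z pY
    din-dout : (X Y : W) (pX : Pure pos X) (pY : Pure pos Y) →
               din X Y pX ⨾ dout X Y pX pY ≅ id (X ++ ⟪ Y ⟫)
    dout-din : (X Y : W) (pX : Pure pos X) (pY : Pure pos Y) →
               dout X Y pX pY ⨾ din X Y pX ≅ id ⟪ X ++ Y ⟫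
    uin-uout : (X Y Z V : W) (pX : Pure neg X) (pY : Pure neg Y) (pV : Pure neg V) →
               uin X Y Z V pX pY pV ⨾ uout X Y Z V pY ≅ id ⟪ X ++ Y ++ ⟪ Z ⟫ ++ V ⟫
    uout-uin : (X Y Z V : W) (pX : Pure neg X) (pY : Pure neg Y) (pV : Pure neg V) →
               uout X Y Z V pY ⨾ uin X Y Z V pX pY pV ≅ id ⟪ X ++ ⟪ Y ++ Z ⟫ ++ V ⟫
    nat-xcup : ∀ {X Y Z V} (t₀ : Tm X Y) → Cov t₀ → (t₁ : Tm Z V) →
               (pX : Pure pos X) (pY : Pure pos Y) →
               (t₀ ⊗ [ id (Y ᵈ) ⊗ t₁ ]) ⨾ xcup Y V pY
               ≅ ((id X ⊗ [ t₀ † ⊗ id Z ]) ⨾ xcup X Z pX) ⨾ [ t₁ ]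
    nat-rcap : ∀ {X Y Z V} (U : W) (t₀ : Tm X Y) → Cov t₀ → (t₁ : Tm Z V) →
               (pX : Pure pos X) (pY : Pure pos Y) →
               ([ id U ⊗ t₁ ] ⨾ rcap U Y V pY) ⨾ [ id U ⊗ (t₀ † ⊗ id (Y ++ V)) ]
               ≅ rcap U X Z pX ⨾ [ id U ⊗ (id (X ᵈ) ⊗ (t₀ ⊗ t₁)) ]
    nat-rcup : ∀ {Y Z U V} (X R : W) (t₀ : Tm Y Z) (t₁ : Tm U V) →
               (pX : Pure pos X) (pR : Pure pos R) →
               ((xcup X (Y ++ R) pX ⊗ id ⟪ R ᵈ ++ U ⟫) ⨾ ([ t₀ ⊗ id R ] ⊗ [ id (R ᵈ) ⊗ t₁ ]))
                 ⨾ rcup Z R V pR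
               ≅ ((id X ⊗ rcup (X ᵈ ++ Y) R U pR)
                    ⨾⟨ cong (λ w → X ++ ⟪ w ⟫) (++-assoc (X ᵈ) Y U) ⟩ xcup X (Y ++ U) pX)
                 ⨾ [ t₀ ⊗ t₁ ]
    yank₁    : (X Y : W) (pX : Pure pos X) →
               (id X ⊗ rcap [] X Y pX) ⨾ xcup X (X ++ Y) pX ≅ din X Y pX
    yank₂    : (X Y Z V : W) (pY : Pure pos Y) →
               rcap X Y (⟪ Y ᵈ ++ Z ⟫ ++ V) pY
                 ⨾⟨ cong (λ w → ⟪ X ++ Y ᵈ ++ w ⟫) (sym (++-assoc Y ⟪ Y ᵈ ++ Z ⟫ V)) ⟩
                 [ id X ⊗ (id (Y ᵈ) ⊗ (xcup Y Z pY ⊗ id V)) ]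
               ≅ uout X (Y ᵈ) Z V (pure-dual pos Y pY)
    yank₃    : (X Z : W) (pX : Pure pos X) →
               (id ⟪ X ⟫ ⊗ rcap [] X Z pX) ⨾ rcup [] X (X ++ Z) pX
               ≅ ((dout' [] X tt pX ⊗ id ⟪ Z ⟫) ⨾ (id ⟪ [] ⟫ ⊗ din X Z pX))
                   ⨾ (bcup ⊗ id ⟪ X ++ Z ⟫)
    bubble₁  : bcap ⨾ bcup ≅ id []
    bubble₂  : bcup ⨾ bcap ≅ id ⟪ [] ⟫
    bubble₃  : (X : W) → (bcap ⊗ id ⟪ X ⟫) ⨾ rcup [] [] X tt ≅ id ⟪ X ⟫
    []-⨾     : ∀ {A B C} (t : Tm A B) (u : Tm B C) → [ t ] ⨾ [ u ] ≅ [ t ⨾ u ]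
    []-id    : (X : W) → [ id X ] ≅ id ⟪ X ⟫

  Hom : CWord Sort → CWord Sort → Set
  Hom X Y = Σ (Tm (word X) (word Y)) Cov

  CΣ-data : SMCData
  CΣ-data = record
    { Obj  = CWord Sort
    ; Hom  = Hom
    ; _≈_  = λ f g → proj₁ f ≅ proj₁ g
    ; idC  = λ {X} → id (word X) , pure X
    ; _⨾_  = λ f g → (proj₁ f ⨾ proj₁ g) , (proj₂ f , proj₂ g)
    ; _⊗₀_ = λ X Y → cw (word X ++ word Y) (pure-++ pos (word X) (word Y) (pure X) (pure Y))
    ; _⊗₁_ = λ f g → (proj₁ f ⊗ proj₁ g) , (proj₂ f , proj₂ g)
    ; 𝟙    = cw [] tt
    ; sym⇒ = λ {X} {Y} → σ (word X) (word Y) , (pure X , pure Y)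
    }

  -- Since concatenation is strictly associative and unital, the associator
  -- and unitors of C_Σ are (up to ≅) identities.
  StrictStructure : IsClosedSymmetricMonoidal CΣ-data → Set
  StrictStructure M =
    (∀ (A B C : CWord Sort) →
       proj₁ (α⇒ {A} {B} {C}) ≅ id ((word A ++ word B) ++ word C))
    × (∀ (A : CWord Sort) → proj₁ (λ⇒ {A}) ≅ id (word A))
    × (∀ (A : CWord Sort) → proj₁ (ρ⇒ {A}) ≅ id (word A ++ []))
    where open IsClosedSymmetricMonoidal M

CΣ : Signature → SMCData
CΣ Sig = Syntax.CΣ-data Sig

StrictCΣ : (Sig : Signature) → IsClosedSymmetricMonoidal (CΣ Sig) → Set
StrictCΣ Sig = Syntax.StrictStructure Sig

{-# OPTIONS --safe #-}
-- The internal hom is B ⊸ C = [B* C], with evaluation given by xcup followed by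
-- the isomorphism [C] ≅ C.  By yank₁ and the naturality of xcup and rcap, din is
-- natural in its covariant argument, so η : A → [A] (bcap followed by din) is a
-- natural isomorphism on covariant terms.  Currying is rcap in [A].  Evaluating a
-- curried term yields it up to the automorphism (B ⊗ η) ; din ; η⁻¹ of B A, so it
-- suffices to precompose with the inverse; whether this automorphism is the
-- identity (a coherence property of din) never matters.  Uniqueness is faithfulness
-- of g ↦ (B ⊗ g) ; xcup: by yank₂, rcap turns it into [g] ; uout, uout is
-- invertible, and [g] determines g by naturality of η.
module Submission where

open import Defs
open import Data.Unit using (tt)
open import Data.Product using (Σ; _,_; proj₁; proj₂)
open import Data.List using ([]; _++_)
open import Data.List.Properties using (++-assoc; ++-identityʳ)
open import Relation.Binary.PropositionalEquality using (_≡_; refl; sym; cong)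

module _ (Sig : Signature) where
  open Signature Sig
  open Syntax Sig

  -- Equational reasoning modulo `_≅_`, and coercions between equal words.

  infix  1 begin_
  infixr 2 _≅⟨_⟩_
  infix  3 _∎

  begin_ : ∀ {A B C D} {t : Tm A B} {u : Tm C D} → t ≅ u → t ≅ u
  begin p = p

  _≅⟨_⟩_ : ∀ {A B C D E F} (t : Tm A B) {u : Tm C D} {v : Tm E F} →
           t ≅ u → u ≅ v → t ≅ v
  _ ≅⟨ p ⟩ q = ≅-trans p q

  _∎ : ∀ {A B} (t : Tm A B) → t ≅ t
  _ ∎ = ≅-refl

  -- An identity term whose two ends are only propositionally equal. As `_≅_` is heterogeneous, such
  -- terms can be erased from composites, so they can serve as associators and right unitors.
  coerce : ∀ {X Y} → X ≡ Y → Tm X Y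
  coerce {X} refl = id X

  coerce-cov : ∀ {X Y} (e : X ≡ Y) → Pure pos X → Cov (coerce e)
  coerce-cov refl p = p

  coerce≅id : ∀ {X Y} (e : X ≡ Y) → coerce e ≅ id X
  coerce≅id refl = ≅-refl

  coerce≅id′ : ∀ {X Y} (e : X ≡ Y) → coerce e ≅ id Y
  coerce≅id′ refl = ≅-refl

  id-cong : ∀ {X Y : W} → X ≡ Y → id X ≅ id Y
  id-cong refl = ≅-refl

  coerce-iso₁ : ∀ {X Y} (e : X ≡ Y) → coerce e ⨾ coerce (sym e) ≅ id X
  coerce-iso₁ refl = idˡ _

  coerce-iso₂ : ∀ {X Y} (e : X ≡ Y) → coerce (sym e) ⨾ coerce e ≅ id Y
  coerce-iso₂ refl = idˡ _

  coerce-⨾ : ∀ {X Y Z} (e : X ≡ Y) (t : Tm Y Z) → coerce e ⨾ t ≅ t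
  coerce-⨾ refl t = idˡ t

  ⨾-coerce : ∀ {X Y Z} (t : Tm X Y) (e : Y ≡ Z) → t ⨾ coerce e ≅ t
  ⨾-coerce t refl = idʳ t

  coerce⊗id-⨾ : ∀ {X Y Z} (e : X ≡ Y) (V : W) (t : Tm (Y ++ V) Z) → (coerce e ⊗ id V) ⨾ t ≅ t
  coerce⊗id-⨾ refl V t = ≅-trans (⨾-cong (⊗-id _ V) ≅-refl) (idˡ t)

  -- Simplifying the two factors may make their middle words definitionally equal; the cast then
  -- disappears.
  ⨾⟨⟩-cong : ∀ {A B B′ C A″ B″ C″} {t : Tm A B} {u : Tm B′ C} {t″ : Tm A″ B″} {u″ : Tm B″ C″}
             (e : B ≡ B′) → t ≅ t″ → u ≅ u″ → t ⨾⟨ e ⟩ u ≅ t″ ⨾ u″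
  ⨾⟨⟩-cong refl p q = ⨾-cong p q

  ⨾⟨⟩-coerce : ∀ {A B B′ C} (t : Tm A B) (e : B ≡ B′) (u : Tm B′ C) →
               t ⨾⟨ e ⟩ u ≅ t ⨾ coerce e ⨾ u
  ⨾⟨⟩-coerce t refl u = ⨾-cong ≅-refl (≅-sym (idˡ u))

  ⨾-congˡ : ∀ {A B C D} {t : Tm A B} {u : Tm B C} {v : Tm B D} → u ≅ v → t ⨾ u ≅ t ⨾ v
  ⨾-congˡ p = ⨾-cong ≅-refl p

  ⨾-congʳ : ∀ {A B C} {t u : Tm A B} {v : Tm B C} → t ≅ u → t ⨾ v ≅ u ⨾ v
  ⨾-congʳ p = ⨾-cong p ≅-refl

  cancel-middle : ∀ {A B C D} {t : Tm A B} {u : Tm B C} {v : Tm C B} {s : Tm B D} →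
                  u ⨾ v ≅ id B → (t ⨾ u) ⨾ (v ⨾ s) ≅ t ⨾ s
  cancel-middle {t = t} {u} {v} {s} p = begin
    (t ⨾ u) ⨾ (v ⨾ s)  ≅⟨ ⨾-assoc t u (v ⨾ s) ⟩
    t ⨾ (u ⨾ (v ⨾ s))  ≅⟨ ⨾-congˡ (≅-sym (⨾-assoc u v s)) ⟩
    t ⨾ ((u ⨾ v) ⨾ s)  ≅⟨ ⨾-congˡ (⨾-congʳ p) ⟩
    t ⨾ (id _ ⨾ s)     ≅⟨ ⨾-congˡ (idˡ s) ⟩
    t ⨾ s              ∎

  id⊗-⨾ : ∀ {A B C} (X : W) (t : Tm A B) (u : Tm B C) →
          (id X ⊗ t) ⨾ (id X ⊗ u) ≅ id X ⊗ (t ⨾ u)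
  id⊗-⨾ X t u = ≅-trans (interchange (id X) t (id X) u) (⊗-cong (idˡ (id X)) ≅-refl)

  id⊗-iso : ∀ {A B} (X : W) {t : Tm A B} {u : Tm B A} →
            t ⨾ u ≅ id A → (id X ⊗ t) ⨾ (id X ⊗ u) ≅ id (X ++ A)
  id⊗-iso X p = ≅-trans (id⊗-⨾ X _ _) (≅-trans (⊗-cong ≅-refl p) (⊗-id X _))

  ⊗-splitʳ : ∀ {A B C D} (t : Tm A B) (u : Tm C D) → t ⊗ u ≅ (id A ⊗ u) ⨾ (t ⊗ id D)
  ⊗-splitʳ t u = ≅-trans (⊗-cong (≅-sym (idˡ t)) (≅-sym (idʳ u)))
                         (≅-sym (interchange (id _) u t (id _)))

  -- Naturality of `xcup`, `rcap` and `din`.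

  xcup-naturalʳ : ∀ {X Z V} (pX : Pure pos X) (t : Tm Z V) →
                  (id X ⊗ [ id (X ᵈ) ⊗ t ]) ⨾ xcup X V pX ≅ xcup X Z pX ⨾ [ t ]
  xcup-naturalʳ {X} {Z} {V} pX t = begin
    (id X ⊗ [ id (X ᵈ) ⊗ t ]) ⨾ xcup X V pX
      ≅⟨ nat-xcup (id X) pX t pX pX ⟩
    ((id X ⊗ [ id X † ⊗ id Z ]) ⨾ xcup X Z pX) ⨾ [ t ]
      ≅⟨ ⨾-congʳ (⨾-congʳ
           (≅-trans (⊗-cong ≅-refl
             (≅-trans ([]-cong (≅-trans (⊗-cong (†-id X) ≅-refl) (⊗-id (X ᵈ) Z))) ([]-id _)))
             (⊗-id X _))) ⟩
    (id _ ⨾ xcup X Z pX) ⨾ [ t ]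
      ≅⟨ ⨾-congʳ (idˡ _) ⟩
    xcup X Z pX ⨾ [ t ] ∎

  -- Trades the `t †` produced by sliding `t` through `xcup` for a `t` on the other strand. It is
  -- `nat-rcap` with `U` empty and `t₁` an identity.
  rcap-dinatural : ∀ {X Y} (Z : W) (pX : Pure pos X) (pY : Pure pos Y) (t : Tm X Y) → Cov t →
                   rcap [] Y Z pY ⨾ [ t † ⊗ id (Y ++ Z) ]
                   ≅ rcap [] X Z pX ⨾ [ id (X ᵈ) ⊗ (t ⊗ id Z) ]
  rcap-dinatural {X} {Y} Z pX pY t c = begin
    rcap [] Y Z pY ⨾ [ t † ⊗ id (Y ++ Z) ]
      ≅⟨ ⨾-cong (≅-sym (≅-trans (⨾-congʳ (≅-trans ([]-cong (⊗-unitˡ (id Z))) ([]-id Z))) (idˡ _)))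
                ([]-cong (≅-sym (⊗-unitˡ _))) ⟩
    ([ id [] ⊗ id Z ] ⨾ rcap [] Y Z pY) ⨾ [ id [] ⊗ (t † ⊗ id (Y ++ Z)) ]
      ≅⟨ nat-rcap [] t c (id Z) pX pY ⟩
    rcap [] X Z pX ⨾ [ id [] ⊗ (id (X ᵈ) ⊗ (t ⊗ id Z)) ]
      ≅⟨ ⨾-congˡ ([]-cong (⊗-unitˡ _)) ⟩
    rcap [] X Z pX ⨾ [ id (X ᵈ) ⊗ (t ⊗ id Z) ] ∎

  rcap-naturalʳ : ∀ {X Z V} (pX : Pure pos X) (t : Tm Z V) →
                  [ t ] ⨾ rcap [] X V pX ≅ rcap [] X Z pX ⨾ [ id (X ᵈ) ⊗ (id X ⊗ t) ]
  rcap-naturalʳ {X} {Z} {V} pX t = begin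
    [ t ] ⨾ rcap [] X V pX
      ≅⟨ ≅-sym (≅-trans (⨾-cong (⨾-congʳ ([]-cong (⊗-unitˡ t)))
           (≅-trans ([]-cong (≅-trans (⊗-unitˡ _)
             (≅-trans (⊗-cong (†-id X) ≅-refl) (⊗-id (X ᵈ) (X ++ V))))) ([]-id _)))
           (idʳ _)) ⟩
    ([ id [] ⊗ t ] ⨾ rcap [] X V pX) ⨾ [ id [] ⊗ (id X † ⊗ id (X ++ V)) ]
      ≅⟨ nat-rcap [] (id X) pX t pX pX ⟩
    rcap [] X Z pX ⨾ [ id [] ⊗ (id (X ᵈ) ⊗ (id X ⊗ t)) ]
      ≅⟨ ⨾-congˡ ([]-cong (⊗-unitˡ _)) ⟩
    rcap [] X Z pX ⨾ [ id (X ᵈ) ⊗ (id X ⊗ t) ] ∎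

  -- `yank₁` unfolds `din` into a bend, `rcap` then `xcup`, and `t` slides around it: `xcup` turns
  -- it into `t †`, `rcap` turns that back into `t` inside the bracket, and `t` leaves through
  -- `xcup`.
  din-naturalˡ : ∀ {X Y} (Z : W) (pX : Pure pos X) (pY : Pure pos Y) (t : Tm X Y) → Cov t →
                 (t ⊗ id ⟪ Z ⟫) ⨾ din Y Z pY ≅ din X Z pX ⨾ [ t ⊗ id Z ]
  din-naturalˡ {X} {Y} Z pX pY t c = begin
    (t ⊗ id ⟪ Z ⟫) ⨾ din Y Z pY
      ≅⟨ ⨾-congˡ (≅-sym (yank₁ Y Z pY)) ⟩
    (t ⊗ id ⟪ Z ⟫) ⨾ (id Y ⊗ rcap [] Y Z pY) ⨾ xcup Y (Y ++ Z) pY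
      ≅⟨ ≅-sym (⨾-assoc _ _ _) ⟩
    ((t ⊗ id ⟪ Z ⟫) ⨾ (id Y ⊗ rcap [] Y Z pY)) ⨾ xcup Y (Y ++ Z) pY
      ≅⟨ ⨾-congʳ (≅-trans (interchange _ _ _ _)
                          (≅-trans (⊗-cong (idʳ t) (idˡ _)) (⊗-splitʳ t _))) ⟩
    ((id X ⊗ rcap [] Y Z pY) ⨾ (t ⊗ id _)) ⨾ xcup Y (Y ++ Z) pY
      ≅⟨ ⨾-assoc _ _ _ ⟩
    (id X ⊗ rcap [] Y Z pY) ⨾ (t ⊗ id _) ⨾ xcup Y (Y ++ Z) pY
      -- The identity on the bracket is expanded into the shape that `nat-xcup` expects, with `t₁`
      -- an identity.
      ≅⟨ ⨾-congˡ (⨾-congʳ (⊗-cong ≅-refl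
           (≅-sym (≅-trans ([]-cong (⊗-id (Y ᵈ) (Y ++ Z))) ([]-id _))))) ⟩
    (id X ⊗ rcap [] Y Z pY) ⨾ (t ⊗ [ id (Y ᵈ) ⊗ id (Y ++ Z) ]) ⨾ xcup Y (Y ++ Z) pY
      ≅⟨ ⨾-congˡ (nat-xcup t c (id (Y ++ Z)) pX pY) ⟩
    (id X ⊗ rcap [] Y Z pY) ⨾
      ((id X ⊗ [ t † ⊗ id (Y ++ Z) ]) ⨾ xcup X (Y ++ Z) pX) ⨾ [ id (Y ++ Z) ]
      ≅⟨ ⨾-congˡ (≅-trans (⨾-congˡ ([]-id _)) (idʳ _)) ⟩
    (id X ⊗ rcap [] Y Z pY) ⨾ (id X ⊗ [ t † ⊗ id (Y ++ Z) ]) ⨾ xcup X (Y ++ Z) pX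
      ≅⟨ ≅-sym (⨾-assoc _ _ _) ⟩
    ((id X ⊗ rcap [] Y Z pY) ⨾ (id X ⊗ [ t † ⊗ id (Y ++ Z) ])) ⨾ xcup X (Y ++ Z) pX
      ≅⟨ ⨾-congʳ (≅-trans (id⊗-⨾ X _ _)
           (≅-trans (⊗-cong ≅-refl (rcap-dinatural Z pX pY t c)) (≅-sym (id⊗-⨾ X _ _)))) ⟩
    ((id X ⊗ rcap [] X Z pX) ⨾ (id X ⊗ [ id (X ᵈ) ⊗ (t ⊗ id Z) ])) ⨾ xcup X (Y ++ Z) pX
      ≅⟨ ⨾-assoc _ _ _ ⟩
    (id X ⊗ rcap [] X Z pX) ⨾ (id X ⊗ [ id (X ᵈ) ⊗ (t ⊗ id Z) ]) ⨾ xcup X (Y ++ Z) pX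
      ≅⟨ ⨾-congˡ (xcup-naturalʳ pX (t ⊗ id Z)) ⟩
    (id X ⊗ rcap [] X Z pX) ⨾ xcup X (X ++ Z) pX ⨾ [ t ⊗ id Z ]
      ≅⟨ ≅-sym (⨾-assoc _ _ _) ⟩
    ((id X ⊗ rcap [] X Z pX) ⨾ xcup X (X ++ Z) pX) ⨾ [ t ⊗ id Z ]
      ≅⟨ ⨾-congʳ (yank₁ X Z pX) ⟩
    din X Z pX ⨾ [ t ⊗ id Z ] ∎

  -- The natural isomorphism between `A` and `⟪ A ⟫`.

  η : (A : W) → Pure pos A → Tm A ⟪ A ⟫
  η A p = coerce (sym (++-identityʳ A)) ⨾ (id A ⊗ bcap) ⨾ din A [] p
            ⨾ coerce (cong ⟪_⟫ (++-identityʳ A))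

  η⁻¹ : (A : W) → Pure pos A → Tm ⟪ A ⟫ A
  η⁻¹ A p = coerce (sym (cong ⟪_⟫ (++-identityʳ A))) ⨾ dout A [] p tt ⨾ (id A ⊗ bcup)
              ⨾ coerce (++-identityʳ A)

  η-cov : (A : W) (p : Pure pos A) → Cov (η A p)
  η-cov A p = coerce-cov (sym (++-identityʳ A)) p , (p , tt) , tt
            , coerce-cov (cong ⟪_⟫ (++-identityʳ A)) (tt , tt)

  η⁻¹-cov : (A : W) (p : Pure pos A) → Cov (η⁻¹ A p)
  η⁻¹-cov A p = coerce-cov (sym (cong ⟪_⟫ (++-identityʳ A))) (tt , tt) , tt , (p , tt)
              , coerce-cov (++-identityʳ A) (pure-++ pos A [] p tt)

  -- The coercions in `η` only bridge `A ++ []` and `A`; the calculations below start from this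
  -- form.
  η-strict : (A : W) (p : Pure pos A) → η A p ≅ (id A ⊗ bcap) ⨾ din A [] p
  η-strict A p = ≅-trans (coerce-⨾ _ _) (⨾-congˡ (⨾-coerce _ _))

  η⁻¹-strict : (A : W) (p : Pure pos A) → η⁻¹ A p ≅ dout A [] p tt ⨾ (id A ⊗ bcup)
  η⁻¹-strict A p = ≅-trans (coerce-⨾ _ _) (⨾-congˡ (⨾-coerce _ _))

  η-η⁻¹ : (A : W) (p : Pure pos A) → η A p ⨾ η⁻¹ A p ≅ id A
  η-η⁻¹ A p = begin
    η A p ⨾ η⁻¹ A p
      ≅⟨ ⨾-cong (η-strict A p) (η⁻¹-strict A p) ⟩
    ((id A ⊗ bcap) ⨾ din A [] p) ⨾ (dout A [] p tt ⨾ (id A ⊗ bcup))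
      ≅⟨ cancel-middle (din-dout A [] p tt) ⟩
    (id A ⊗ bcap) ⨾ (id A ⊗ bcup)
      ≅⟨ ≅-trans (id⊗-⨾ A _ _) (⊗-cong ≅-refl bubble₁) ⟩
    id A ⊗ id []
      ≅⟨ ⊗-unitʳ (id A) ⟩
    id A ∎

  η⁻¹-η : (A : W) (p : Pure pos A) → η⁻¹ A p ⨾ η A p ≅ id ⟪ A ⟫
  η⁻¹-η A p = begin
    η⁻¹ A p ⨾ η A p
      ≅⟨ ⨾-cong (η⁻¹-strict A p) (η-strict A p) ⟩
    (dout A [] p tt ⨾ (id A ⊗ bcup)) ⨾ ((id A ⊗ bcap) ⨾ din A [] p)
      ≅⟨ cancel-middle (id⊗-iso A bubble₂) ⟩
    dout A [] p tt ⨾ din A [] p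
      ≅⟨ dout-din A [] p tt ⟩
    id ⟪ A ++ [] ⟫
      ≅⟨ id-cong (cong ⟪_⟫ (++-identityʳ A)) ⟩
    id ⟪ A ⟫ ∎

  η-natural : ∀ {A B} (pA : Pure pos A) (pB : Pure pos B) (t : Tm A B) → Cov t →
              t ⨾ η B pB ≅ η A pA ⨾ [ t ]
  η-natural {A} {B} pA pB t c = begin
    t ⨾ η B pB
      ≅⟨ ⨾-cong (≅-sym (⊗-unitʳ t)) (η-strict B pB) ⟩
    (t ⊗ id []) ⨾ (id B ⊗ bcap) ⨾ din B [] pB
      ≅⟨ ≅-sym (⨾-assoc _ _ _) ⟩
    ((t ⊗ id []) ⨾ (id B ⊗ bcap)) ⨾ din B [] pB
      ≅⟨ ⨾-congʳ (≅-trans (interchange _ _ _ _)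
                          (≅-trans (⊗-cong (idʳ t) (idˡ _)) (⊗-splitʳ t bcap))) ⟩
    ((id A ⊗ bcap) ⨾ (t ⊗ id ⟪ [] ⟫)) ⨾ din B [] pB
      ≅⟨ ⨾-assoc _ _ _ ⟩
    (id A ⊗ bcap) ⨾ (t ⊗ id ⟪ [] ⟫) ⨾ din B [] pB
      ≅⟨ ⨾-congˡ (din-naturalˡ [] pA pB t c) ⟩
    (id A ⊗ bcap) ⨾ din A [] pA ⨾ [ t ⊗ id [] ]
      ≅⟨ ≅-sym (⨾-assoc _ _ _) ⟩
    ((id A ⊗ bcap) ⨾ din A [] pA) ⨾ [ t ⊗ id [] ]
      ≅⟨ ⨾-cong (≅-sym (η-strict A pA)) ([]-cong (⊗-unitʳ t)) ⟩
    η A pA ⨾ [ t ] ∎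

  -- Recovers a covariant term from its bracket. It serves twice: to unbracket a curried term in
  -- `curryˡ-β`, and to pass from `[ g ] ≅ [ h ]` to `g ≅ h` in `evˡ-faithful`.
  η-conjugate : ∀ {A B} (pA : Pure pos A) (pB : Pure pos B) (t : Tm A B) → Cov t →
                η A pA ⨾ [ t ] ⨾ η⁻¹ B pB ≅ t
  η-conjugate {A} {B} pA pB t c = begin
    η A pA ⨾ [ t ] ⨾ η⁻¹ B pB      ≅⟨ ≅-sym (⨾-assoc _ _ _) ⟩
    (η A pA ⨾ [ t ]) ⨾ η⁻¹ B pB    ≅⟨ ⨾-congʳ (≅-sym (η-natural pA pB t c)) ⟩
    (t ⨾ η B pB) ⨾ η⁻¹ B pB        ≅⟨ ⨾-assoc _ _ _ ⟩
    t ⨾ η B pB ⨾ η⁻¹ B pB          ≅⟨ ⨾-congˡ (η-η⁻¹ B pB) ⟩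
    t ⨾ id B                       ≅⟨ idʳ t ⟩
    t                              ∎

  -- Evaluation and currying with the argument on the left.

  -- The argument `B` stands on the left because `xcup` absorbs from that side; the symmetry
  -- restores the order later.
  evˡ : (B C : W) → Pure pos B → Pure pos C → Tm (B ++ ⟪ B ᵈ ++ C ⟫) C
  evˡ B C pB pC = xcup B C pB ⨾ η⁻¹ C pC

  -- The inverse of the automorphism (B ⊗ η) ; din ; η⁻¹ of B A.
  twist : (A B : W) → Pure pos A → Pure pos B → Tm (B ++ A) (B ++ A)
  twist A B pA pB = η (B ++ A) (pure-++ pos B A pB pA) ⨾ dout B A pB pA ⨾ (id B ⊗ η⁻¹ A pA)

  twist-cov : (A B : W) (pA : Pure pos A) (pB : Pure pos B) → Cov (twist A B pA pB)
  twist-cov A B pA pB = η-cov (B ++ A) (pure-++ pos B A pB pA) , tt , pB , η⁻¹-cov A pA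

  -- `rcap` creates strands only inside a bracket, hence the initial `η`: `A` becomes `⟪ A ⟫`, then
  -- `⟪ B ᵈ ++ B ++ A ⟫`, and `t` acts under the bracket beside `B ᵈ`.
  curryˡ : ∀ {A B C} → Pure pos A → Pure pos B → Tm (B ++ A) C → Tm A ⟪ B ᵈ ++ C ⟫
  curryˡ {A} {B} pA pB t = η A pA ⨾ rcap [] B A pB ⨾ [ id (B ᵈ) ⊗ (twist A B pA pB ⨾ t) ]

  -- Naturality moves the bracketed term past `xcup`, and `yank₁` straightens the remaining bend to
  -- `din`. Unbracketing then leaves exactly the automorphism that `twist` inverts.
  curryˡ-β : ∀ {A B C} (pA : Pure pos A) (pB : Pure pos B) (pC : Pure pos C)
             (t : Tm (B ++ A) C) → Cov t →
             (id B ⊗ curryˡ pA pB t) ⨾ evˡ B C pB pC ≅ t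
  curryˡ-β {A} {B} {C} pA pB pC t c = begin
    (id B ⊗ curryˡ pA pB t) ⨾ xcup B C pB ⨾ η⁻¹ C pC
      ≅⟨ ⨾-congʳ (≅-sym (≅-trans (⨾-congˡ (id⊗-⨾ B _ _)) (id⊗-⨾ B _ _))) ⟩
    ((id B ⊗ η A pA) ⨾ (id B ⊗ rcap [] B A pB) ⨾ (id B ⊗ [ id (B ᵈ) ⊗ s ]))
      ⨾ xcup B C pB ⨾ η⁻¹ C pC
      ≅⟨ ≅-trans (⨾-assoc _ _ _) (⨾-congˡ (≅-trans (⨾-assoc _ _ _) (⨾-congˡ (≅-sym (⨾-assoc _ _ _))))) ⟩
    (id B ⊗ η A pA) ⨾ (id B ⊗ rcap [] B A pB)
      ⨾ ((id B ⊗ [ id (B ᵈ) ⊗ s ]) ⨾ xcup B C pB) ⨾ η⁻¹ C pC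
      ≅⟨ ⨾-congˡ (⨾-congˡ (≅-trans (⨾-congʳ (xcup-naturalʳ pB s)) (⨾-assoc _ _ _))) ⟩
    (id B ⊗ η A pA) ⨾ (id B ⊗ rcap [] B A pB) ⨾ xcup B (B ++ A) pB ⨾ [ s ] ⨾ η⁻¹ C pC
      ≅⟨ ⨾-congˡ (≅-trans (≅-sym (⨾-assoc _ _ _)) (⨾-congʳ (yank₁ B A pB))) ⟩
    (id B ⊗ η A pA) ⨾ din B A pB ⨾ [ s ] ⨾ η⁻¹ C pC
      -- Inserting `η⁻¹ ⨾ η` before `[ s ]` sets up `η-conjugate`, which replaces the bracketed `s`
      -- by `s` itself.
      ≅⟨ ⨾-congˡ (⨾-congˡ (≅-trans
           (≅-sym (≅-trans (⨾-congʳ (η⁻¹-η _ pBA)) (idˡ _))) (⨾-assoc _ _ _))) ⟩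
    (id B ⊗ η A pA) ⨾ din B A pB ⨾ η⁻¹ (B ++ A) pBA ⨾ η (B ++ A) pBA ⨾ [ s ] ⨾ η⁻¹ C pC
      ≅⟨ ⨾-congˡ (⨾-congˡ (⨾-congˡ (η-conjugate pBA pC s (twist-cov A B pA pB , c)))) ⟩
    (id B ⊗ η A pA) ⨾ din B A pB ⨾ η⁻¹ (B ++ A) pBA ⨾ s
      -- Once `twist` is unfolded, its three factors cancel in turn against `η⁻¹`, `din` and
      -- `id B ⊗ η A pA`.
      ≅⟨ ⨾-congˡ (⨾-congˡ (⨾-congˡ (≅-trans (⨾-assoc _ _ _) (⨾-congˡ (⨾-assoc _ _ _))))) ⟩
    (id B ⊗ η A pA) ⨾ din B A pB ⨾ η⁻¹ (B ++ A) pBA ⨾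
      η (B ++ A) pBA ⨾ dout B A pB pA ⨾ (id B ⊗ η⁻¹ A pA) ⨾ t
      ≅⟨ ⨾-congˡ (⨾-congˡ (cancel (η⁻¹-η _ pBA))) ⟩
    (id B ⊗ η A pA) ⨾ din B A pB ⨾ dout B A pB pA ⨾ (id B ⊗ η⁻¹ A pA) ⨾ t
      ≅⟨ ⨾-congˡ (cancel (din-dout B A pB pA)) ⟩
    (id B ⊗ η A pA) ⨾ (id B ⊗ η⁻¹ A pA) ⨾ t
      ≅⟨ cancel (id⊗-iso B (η-η⁻¹ A pA)) ⟩
    t ∎
    where
    pBA : Pure pos (B ++ A)
    pBA = pure-++ pos B A pB pA
    s : Tm (B ++ A) C
    s = twist A B pA pB ⨾ t
    cancel : ∀ {X Y Z} {u : Tm X Y} {v : Tm Y X} {w : Tm X Z} → u ⨾ v ≅ id X → u ⨾ v ⨾ w ≅ w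
    cancel p = ≅-trans (≅-sym (⨾-assoc _ _ _)) (≅-trans (⨾-congʳ p) (idˡ _))

  -- Faithfulness of evaluation.

  rcap-xcup : (B C : W) (pB : Pure pos B) →
              rcap [] B ⟪ B ᵈ ++ C ⟫ pB ⨾ [ id (B ᵈ) ⊗ xcup B C pB ]
              ≅ uout [] (B ᵈ) C [] (pure-dual pos B pB)
  rcap-xcup B C pB =
    -- `yank₂` is taken with both outer words empty; the unit laws strip the padding identities.
    ≅-trans (≅-sym (⨾⟨⟩-cong _ ≅-refl
                      ([]-cong (≅-trans (⊗-unitˡ _) (⊗-cong ≅-refl (⊗-unitʳ _))))))
            (yank₂ [] B C [] pB)

  -- The right side involves `g` only through `(id B ⊗ g) ⨾ xcup B C pB`, so that composite
  -- determines `[ g ]`. Naturality of `rcap` moves `[ g ]` to the front; what follows it is `uout`,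
  -- which `uin` undoes.
  bracket-from-xcup : ∀ {A B C} (pB : Pure pos B) (g : Tm A ⟪ B ᵈ ++ C ⟫) →
    [ g ] ≅ (rcap [] B A pB ⨾ [ id (B ᵈ) ⊗ ((id B ⊗ g) ⨾ xcup B C pB) ])
              ⨾ uin [] (B ᵈ) C [] tt (pure-dual pos B pB) tt
  bracket-from-xcup {A} {B} {C} pB g = ≅-sym (begin
    (rcap [] B A pB ⨾ [ id (B ᵈ) ⊗ ((id B ⊗ g) ⨾ xcup B C pB) ]) ⨾ in′
      ≅⟨ ⨾-congʳ (⨾-congˡ (≅-sym (≅-trans ([]-⨾ _ _) ([]-cong (id⊗-⨾ (B ᵈ) _ _))))) ⟩
    (rcap [] B A pB ⨾ [ id (B ᵈ) ⊗ (id B ⊗ g) ] ⨾ [ id (B ᵈ) ⊗ xcup B C pB ]) ⨾ in′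
      ≅⟨ ⨾-congʳ (≅-trans (≅-sym (⨾-assoc _ _ _)) (⨾-congʳ (≅-sym (rcap-naturalʳ pB g)))) ⟩
    (([ g ] ⨾ rcap [] B ⟪ B ᵈ ++ C ⟫ pB) ⨾ [ id (B ᵈ) ⊗ xcup B C pB ]) ⨾ in′
      ≅⟨ ⨾-congʳ (≅-trans (⨾-assoc _ _ _) (⨾-congˡ (rcap-xcup B C pB))) ⟩
    ([ g ] ⨾ uout [] (B ᵈ) C [] (pure-dual pos B pB)) ⨾ in′
      -- `uout-uin` asks for contravariant outer words; here both are empty.
      ≅⟨ ≅-trans (⨾-assoc _ _ _)
           (⨾-congˡ (uout-uin [] (B ᵈ) C [] tt (pure-dual pos B pB) tt)) ⟩
    [ g ] ⨾ id _
      ≅⟨ idʳ _ ⟩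
    [ g ] ∎)
    where
    in′ : Tm ⟪ B ᵈ ++ ⟪ C ⟫ ⟫ ⟪ ⟪ B ᵈ ++ C ⟫ ⟫
    in′ = uin [] (B ᵈ) C [] tt (pure-dual pos B pB) tt

  evˡ-faithful : ∀ {A B C} (pA : Pure pos A) (pB : Pure pos B) (pC : Pure pos C)
                 (g h : Tm A ⟪ B ᵈ ++ C ⟫) → Cov g → Cov h →
                 (id B ⊗ g) ⨾ evˡ B C pB pC ≅ (id B ⊗ h) ⨾ evˡ B C pB pC → g ≅ h
  evˡ-faithful {A} {B} {C} pA pB pC g h cg ch eq = begin
    -- A bracket is a covariant letter even when its contents are mixed, so `η` is available at
    -- `⟪ B ᵈ ++ C ⟫`.
    g                                          ≅⟨ ≅-sym (η-conjugate pA (tt , tt) g cg) ⟩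
    η A pA ⨾ [ g ] ⨾ η⁻¹ ⟪ B ᵈ ++ C ⟫ (tt , tt)  ≅⟨ ⨾-congˡ (⨾-congʳ brackets) ⟩
    η A pA ⨾ [ h ] ⨾ η⁻¹ ⟪ B ᵈ ++ C ⟫ (tt , tt)  ≅⟨ η-conjugate pA (tt , tt) h ch ⟩
    h                                          ∎
    where
    drop-η⁻¹ : (k : Tm A ⟪ B ᵈ ++ C ⟫) →
               ((id B ⊗ k) ⨾ evˡ B C pB pC) ⨾ η C pC ≅ (id B ⊗ k) ⨾ xcup B C pB
    drop-η⁻¹ k = ≅-trans (⨾-assoc _ _ _) (⨾-congˡ
      (≅-trans (⨾-assoc _ _ _) (≅-trans (⨾-congˡ (η⁻¹-η C pC)) (idʳ _))))
    xcups : (id B ⊗ g) ⨾ xcup B C pB ≅ (id B ⊗ h) ⨾ xcup B C pB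
    xcups = ≅-trans (≅-sym (drop-η⁻¹ g)) (≅-trans (⨾-congʳ eq) (drop-η⁻¹ h))
    brackets : [ g ] ≅ [ h ]
    brackets = ≅-trans (bracket-from-xcup pB g)
      (≅-trans (⨾-congʳ (⨾-congˡ ([]-cong (⊗-cong ≅-refl xcups))))
               (≅-sym (bracket-from-xcup pB h)))

  -- Moving the argument to the right by the symmetry.

  σ-ev : ∀ {A B H C} (g : Tm A H) (e : Tm (B ++ H) C) →
         (g ⊗ id B) ⨾ σ H B ⨾ e ≅ σ A B ⨾ (id B ⊗ g) ⨾ e
  σ-ev g e = ≅-trans (≅-sym (⨾-assoc _ _ _))
                     (≅-trans (⨾-congʳ (σ-nat g (id _))) (⨾-assoc _ _ _))

  -- Turns an equation about right-handed evaluation into the left-handed form that `evˡ-faithful`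
  -- accepts.
  σ-transpose : ∀ {A B C} {t : Tm (A ++ B) C} {u : Tm (B ++ A) C} →
                σ A B ⨾ u ≅ t → u ≅ σ B A ⨾ t
  σ-transpose {A} {B} {u = u} p = ≅-trans (≅-sym (idˡ u))
    (≅-trans (⨾-congʳ (≅-sym (σ-inv B A))) (≅-trans (⨾-assoc _ _ _) (⨾-congˡ p)))

  curry-σ-β : ∀ {A B C} (pA : Pure pos A) (pB : Pure pos B) (pC : Pure pos C)
              (t : Tm (A ++ B) C) → Cov t →
              (curryˡ pA pB (σ B A ⨾ t) ⊗ id B) ⨾ σ ⟪ B ᵈ ++ C ⟫ B ⨾ evˡ B C pB pC ≅ t
  curry-σ-β {A} {B} {C} pA pB pC t c = begin
    (curryˡ pA pB (σ B A ⨾ t) ⊗ id B) ⨾ σ ⟪ B ᵈ ++ C ⟫ B ⨾ evˡ B C pB pC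
      ≅⟨ σ-ev _ _ ⟩
    σ A B ⨾ (id B ⊗ curryˡ pA pB (σ B A ⨾ t)) ⨾ evˡ B C pB pC
      ≅⟨ ⨾-congˡ (curryˡ-β pA pB pC (σ B A ⨾ t) ((pB , pA) , c)) ⟩
    σ A B ⨾ σ B A ⨾ t
      ≅⟨ ≅-sym (⨾-assoc _ _ _) ⟩
    (σ A B ⨾ σ B A) ⨾ t
      ≅⟨ ⨾-congʳ (σ-inv A B) ⟩
    id (A ++ B) ⨾ t
      ≅⟨ idˡ t ⟩
    t ∎

  -- Assembling the closed symmetric monoidal structure.

  α : (X Y Z : CWord Sort) → (word X ++ word Y) ++ word Z ≡ word X ++ (word Y ++ word Z)
  α X Y Z = ++-assoc (word X) (word Y) (word Z)

  pure-assoc : (X Y Z : CWord Sort) → Pure pos ((word X ++ word Y) ++ word Z)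
  pure-assoc X Y Z = pure-++ pos (word X ++ word Y) (word Z)
    (pure-++ pos (word X) (word Y) (pure X) (pure Y)) (pure Z)

  pure-assoc′ : (X Y Z : CWord Sort) → Pure pos (word X ++ (word Y ++ word Z))
  pure-assoc′ X Y Z = pure-++ pos (word X) (word Y ++ word Z)
    (pure X) (pure-++ pos (word Y) (word Z) (pure Y) (pure Z))

  closedSymmetricMonoidal : IsClosedSymmetricMonoidal (CΣ Sig)
  closedSymmetricMonoidal = record
    { ≈-equiv = record { refl = ≅-refl ; sym = ≅-sym ; trans = ≅-trans }
    ; ⨾-cong  = ⨾-cong
    ; idˡ     = λ f → idˡ (proj₁ f)
    ; idʳ     = λ f → idʳ (proj₁ f)
    ; assoc   = λ f g h → ⨾-assoc (proj₁ f) (proj₁ g) (proj₁ h)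
    ; ⊗-cong  = ⊗-cong
    ; ⊗-id    = λ {A} {B} → ⊗-id (word A) (word B)
    ; ⊗-⨾     = λ f g f′ g′ → ≅-sym (interchange (proj₁ f) (proj₁ f′) (proj₁ g) (proj₁ g′))
    ; α⇒      = λ {A} {B} {C} → coerce (α A B C) , coerce-cov (α A B C) (pure-assoc A B C)
    ; α⇐      = λ {A} {B} {C} → coerce (sym (α A B C))
                              , coerce-cov (sym (α A B C)) (pure-assoc′ A B C)
    ; α-iso₁  = λ {A} {B} {C} → coerce-iso₁ (α A B C)
    ; α-iso₂  = λ {A} {B} {C} → coerce-iso₂ (α A B C)
    ; α-nat   = λ f g h → ≅-trans (⨾-coerce _ _) (≅-trans (⊗-assoc (proj₁ f) (proj₁ g) (proj₁ h))
                                                          (≅-sym (coerce-⨾ _ _)))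
    -- `[] ++ A` reduces to `A`, so identities suffice here, whereas `A ++ []` calls for coercions.
    ; λ⇒      = λ {A} → id (word A) , pure A
    ; λ⇐      = λ {A} → id (word A) , pure A
    ; λ-iso₁  = idˡ _
    ; λ-iso₂  = idˡ _
    ; λ-nat   = λ f → ≅-trans (idʳ _) (≅-trans (⊗-unitˡ (proj₁ f)) (≅-sym (idˡ _)))
    ; ρ⇒      = λ {A} → coerce (++-identityʳ (word A))
                      , coerce-cov (++-identityʳ (word A)) (pure-++ pos (word A) [] (pure A) tt)
    ; ρ⇐      = λ {A} → coerce (sym (++-identityʳ (word A)))
                      , coerce-cov (sym (++-identityʳ (word A))) (pure A)
    ; ρ-iso₁  = λ {A} → coerce-iso₁ (++-identityʳ (word A))
    ; ρ-iso₂  = λ {A} → coerce-iso₂ (++-identityʳ (word A))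
    ; ρ-nat   = λ f → ≅-trans (⨾-coerce _ _) (≅-trans (⊗-unitʳ (proj₁ f)) (≅-sym (coerce-⨾ _ _)))
    -- Both sides collapse to the identity on the common target word; the triangle goes the same
    -- way.
    ; pentagon = λ {A} {B} {C} {E} →
        ≅-trans (coerce-⨾ _ _) (≅-trans (coerce≅id′ (++-assoc (word A) (word B) (word C ++ word E)))
          (≅-sym (≅-trans (coerce⊗id-⨾ (α A B C) (word E) _) (≅-trans (coerce-⨾ _ _)
            (≅-trans (⊗-cong ≅-refl (coerce≅id′ (α B C E))) (⊗-id _ _))))))
    ; triangle = λ {A} {B} →
        ≅-trans (coerce-⨾ _ _) (≅-trans (⊗-id _ _)
          (≅-sym (≅-trans (⊗-cong (coerce≅id′ (++-identityʳ (word A))) ≅-refl) (⊗-id _ _))))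
    ; sym-nat = λ f g → σ-nat (proj₁ f) (proj₁ g)
    ; sym-inv = λ {A} {B} → σ-inv (word A) (word B)
    -- Erasing the outer associators leaves a single symmetry for `hexagon₁` to split; the cast in
    -- that axiom then becomes the middle associator.
    ; hexagon = λ {A} {B} {C} →
        ≅-trans (coerce-⨾ _ _) (≅-trans (⨾-coerce _ _)
          (≅-trans (hexagon₁ (word A) (word B) (word C)) (⨾⟨⟩-coerce _ _ _)))
    ; _⊸_     = λ B C → cw ⟪ word B ᵈ ++ word C ⟫ (tt , tt)
    ; ev      = λ {B} {C} → (σ _ (word B) ⨾ evˡ (word B) (word C) (pure B) (pure C))
                          , ((tt , tt) , pure B) , tt , η⁻¹-cov (word C) (pure C)
    ; curry   = λ {A} {B} f → curryˡ (pure A) (pure B) (σ (word B) (word A) ⨾ proj₁ f)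
                            , η-cov (word A) (pure A) , tt , tt
    ; curry-β = λ {A} {B} {C} f → curry-σ-β (pure A) (pure B) (pure C) (proj₁ f) (proj₂ f)
    ; curry-η = λ {A} {B} {C} f g p →
        evˡ-faithful (pure A) (pure B) (pure C) (proj₁ g) _ (proj₂ g)
          (η-cov (word A) (pure A) , tt , tt)
          -- By `p` and by the β law, `g` and the curried `f` both evaluate on the left to
          -- `σ B A ⨾ f`, so faithfulness identifies them.
          (≅-trans (σ-transpose (≅-trans (≅-sym (σ-ev _ _)) p))
                   (≅-sym (σ-transpose (≅-trans (≅-sym (σ-ev _ _))
                     (curry-σ-β (pure A) (pure B) (pure C) (proj₁ f) (proj₂ f))))))
    }

theorem10 : (Sig : Signature) →
    Σ (IsClosedSymmetricMonoidal (CΣ Sig)) (StrictCΣ Sig)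
theorem10 Sig = closedSymmetricMonoidal Sig
  , (λ A B C → coerce≅id Sig (α Sig A B C))
  , (λ A → Syntax.≅-refl)
  , (λ A → coerce≅id Sig (++-identityʳ (word A)))
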